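{- For every $\varepsilon>0$ there exist $\delta>0$ and a constant $K>0$ such that for every constant $C>0$ there is a constant $c>0$ and infinitely many positive integers $n$ for which there exists an $n$-vertex directed unweighted graph $G=(V,E)$ with $|E|\le Kn$ such that for every shortcut set $H$ of $G$ with $|H|\le C n^{2-\varepsilon}$, the graph $G\cup H$ has diameter at least $c\, n^{\delta}$.
   Context: For a directed graph $G=(V,E)$, a shortcut set is a set $H$ of ordered pairs $(u,v)$ of distinct vertices such that $v$ is reachable from $u$ in $G$. $G\cup H$ denotes $(V,E\cup H)$. The diameter of a directed graph is $\max \mathrm{dist}(u,v)$ over all ordered pairs $(u,v)$ with $v$ reachable from $u$, with $\mathrm{dist}$ the unweighted shortest-path distance. -}

module Defs where

open import Data.Nat using (ℕ; zero; suc; _^_)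
open import Data.Integer using (ℤ; +_; -[1+_])
open import Data.Rational using (ℚ; ↥_; ↧ₙ_; _/_; _*_; _≤_; 1ℚ)
open import Data.Bool using (Bool; true; false; if_then_else_; _∨_; T)
open import Data.Fin using (Fin)
open import Data.List using (List; map; allFin)
open import Data.Nat.ListAction using (sum)
open import Data.Product using (Σ; _×_; ∃)
open import Relation.Binary.PropositionalEquality using (_≢_)

_^ℚ_ : ℚ → ℕ → ℚ
p ^ℚ zero = 1ℚ
p ^ℚ suc k = p * (p ^ℚ k)

toℚ : ℕ → ℚ
toℚ x = + x / 1

-- For x : ℕ, C ≥ 0, n ≥ 1 and a rational exponent e = a / b (b ≥ 1, in
-- lowest terms):   AtMostCPow x C n e   means   x ≤ C · n^e   (real power).
-- Since both sides are ≥ 0 this is equivalent to x^b ≤ C^b · n^a, where a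
-- negative a is handled by moving n^(-a) to the left.
atMostAux : ℕ → ℚ → ℕ → ℤ → ℕ → Set
atMostAux x C n (+ m)      b = (toℚ x ^ℚ b) ≤ ((C ^ℚ b) * toℚ (n ^ m))
atMostAux x C n (-[1+ m ]) b = ((toℚ x ^ℚ b) * toℚ (n ^ suc m)) ≤ (C ^ℚ b)

AtMostCPow : ℕ → ℚ → ℕ → ℚ → Set
AtMostCPow x C n e = atMostAux x C n (↥ e) (↧ₙ e)

-- AtLeastCPow k c n e  means  c · n^e ≤ k   (for c ≥ 0, n ≥ 1, k : ℕ).
atLeastAux : ℕ → ℚ → ℕ → ℤ → ℕ → Set
atLeastAux k c n (+ m)      b = ((c ^ℚ b) * toℚ (n ^ m)) ≤ (toℚ k ^ℚ b)
atLeastAux k c n (-[1+ m ]) b = (c ^ℚ b) ≤ ((toℚ k ^ℚ b) * toℚ (n ^ suc m))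

AtLeastCPow : ℕ → ℚ → ℕ → ℚ → Set
AtLeastCPow k c n e = atLeastAux k c n (↥ e) (↧ₙ e)

Graph : ℕ → Set
Graph n = Fin n → Fin n → Bool

size : ∀ {n} → Graph n → ℕ
size {n} E = sum (map (λ u → sum (map (λ v → if E u v then 1 else 0) (allFin n))) (allFin n))

_∪_ : ∀ {n} → Graph n → Graph n → Graph n
(E ∪ H) u v = E u v ∨ H u v

data Walk {n : ℕ} (E : Graph n) : Fin n → Fin n → ℕ → Set where
  here : ∀ {u} → Walk E u u 0
  step : ∀ {u v w k} → T (E u v) → Walk E v w k → Walk E u w (suc k)

Reachable : ∀ {n} → Graph n → Fin n → Fin n → Set
Reachable E u v = ∃ λ k → Walk E u v k

ShortcutSet : ∀ {n} → Graph n → Graph n → Set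
ShortcutSet G H = ∀ u v → T (H u v) → (u ≢ v) × Reachable G u v

DiameterAtLeast : ∀ {n} → Graph n → ℚ → ℚ → Set
DiameterAtLeast {n} E c δ =
  Σ (Fin n) λ u → Σ (Fin n) λ v →
    Reachable E u v × (∀ k → Walk E u v k → AtLeastCPow k c n δ)

{-# OPTIONS --safe #-}
-- A layered graph: a vertex is (t , x , y) with x ∈ ℕ^k, and the edge with label b < s out of
-- layer t adds b to the coordinate x_{t mod k} and b² to y.  For a ∈ ℕ^k, completing the square
-- gives a potential y + Σ_{t′<t} a_{t′ mod k}² − 2 a·x that grows by (b − a_{t mod k})² ≥ 0 along
-- an edge, so the walk that always uses b = a_{t mod k} is the only walk between its endpoints,
-- and a shortcut used by a walk between them has both its ends on it.  A shortcut spanning at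
-- least k layers changes every coordinate and thereby determines x and a.  Hence if H has fewer
-- edges than there are pairs (x , a), some pair has only shortcuts spanning fewer than k layers,
-- and q layers cost at least q / k steps.  Adding isolated vertices (the pad component, again of
-- range s) makes the number of edges at most the number n of vertices.
--
-- With s = q^k, initial x_i < q^(k+1) and q layers, n = q^((k+1)(k+4)) and there are q^(k(2k+1))
-- pairs, so the exponent k(2k+1) / ((k+1)(k+4)) tends to 2 as k grows.
module Submission where

-- Counting the edges of a graph by injections.

module EdgeCount where

  open import Defs
  open import Data.Nat using (suc; _≤_; _+_)
  open import Data.Bool using (true; false; if_then_else_; T)
  open import Data.Bool.Properties using (T?)
  open import Data.Fin using (Fin)
  open import Data.Fin.Properties using (injective⇒≤)
  open import Data.List using (List; []; _∷_; map; length; filter; cartesianProduct; allFin; lookup; _++_)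
  open import Data.List.Properties using (length-++; filter-++)
  open import Data.Nat.ListAction using (sum)
  import Data.List.Relation.Unary.All as All
  open import Data.List.Relation.Unary.AllPairs using (_∷_)
  open import Data.List.Relation.Unary.Any using (index)
  open import Data.List.Relation.Unary.Any.Properties using (lookup-index)
  open import Data.List.Relation.Unary.Unique.Propositional using (Unique)
  open import Data.List.Relation.Unary.Unique.Propositional.Properties using (cartesianProduct⁺; allFin⁺; filter⁺)
  open import Data.List.Membership.Propositional using (_∈_)
  open import Data.List.Membership.Propositional.Properties using (∈-filter⁺; ∈-filter⁻; ∈-cartesianProduct⁺; ∈-allFin; ∈-lookup)
  open import Data.Product using (_×_; _,_; proj₂; uncurry)
  open import Relation.Nullary using (contradiction)
  open import Relation.Unary using (Decidable)
  open import Relation.Binary.PropositionalEquality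
  open import Function using (_∘_)
  open import Function.Definitions using (Injective)

  lookup-injective : ∀ {A : Set} {xs : List A} → Unique xs → Injective _≡_ _≡_ (lookup xs)
  lookup-injective (px ∷ u) {Fin.zero} {Fin.zero} eq = refl
  lookup-injective {xs = _ ∷ xs} (px ∷ u) {Fin.zero} {Fin.suc j} eq = contradiction eq (All.lookup px (∈-lookup j))
  lookup-injective {xs = _ ∷ xs} (px ∷ u) {Fin.suc i} {Fin.zero} eq = contradiction (sym eq) (All.lookup px (∈-lookup i))
  lookup-injective (px ∷ u) {Fin.suc i} {Fin.suc j} eq = cong Fin.suc (lookup-injective u eq)

  module _ {n} (E : Graph n) where

    edge? : Decidable (T ∘ uncurry E)
    edge? (u , v) = T? (E u v)

    -- Having no repetitions, this list lets its indices stand for the edges; `length-edges` turns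
    -- the double sum in `size` into its length.
    edges : List (Fin n × Fin n)
    edges = filter edge? (cartesianProduct (allFin n) (allFin n))

    private
      row : ∀ u vs → length (filter edge? (map (u ,_) vs)) ≡ sum (map (λ v → if E u v then 1 else 0) vs)
      row u [] = refl
      row u (v ∷ vs) with E u v
      ... | true  = cong suc (row u vs)
      ... | false = row u vs

      rows : ∀ us vs → length (filter edge? (cartesianProduct us vs)) ≡
                       sum (map (λ u → sum (map (λ v → if E u v then 1 else 0) vs)) us)
      rows [] vs = refl
      rows (u ∷ us) vs = begin
        length (filter edge? (map (u ,_) vs ++ cartesianProduct us vs))
          ≡⟨ cong length (filter-++ edge? (map (u ,_) vs) _) ⟩
        length (filter edge? (map (u ,_) vs) ++ filter edge? (cartesianProduct us vs))
          ≡⟨ length-++ (filter edge? (map (u ,_) vs)) ⟩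
        length (filter edge? (map (u ,_) vs)) + length (filter edge? (cartesianProduct us vs))
          ≡⟨ cong₂ _+_ (row u vs) (rows us vs) ⟩
        _ ∎
        where open ≡-Reasoning

    length-edges : length edges ≡ size E
    length-edges = rows (allFin n) (allFin n)

    -- The map `f` may depend on the proof that the pair is an edge, because the label of an edge
    -- will be extracted from that proof. Comparing the endpoints alone suffices, since `edges`
    -- lists each pair at most once.
    size-≤ : ∀ {m} (f : ∀ u v → T (E u v) → Fin m) →
             (∀ {u v u′ v′} e e′ → f u v e ≡ f u′ v′ e′ → (u , v) ≡ (u′ , v′)) →
             size E ≤ m
    size-≤ {m} f f-inj = subst (_≤ m) length-edges
      (injective⇒≤ {f = λ i → f _ _ (isEdge i)} (λ eq → lookup-injective unique (f-inj _ _ eq)))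
      where
      unique : Unique edges
      unique = filter⁺ edge? (cartesianProduct⁺ (allFin⁺ n) (allFin⁺ n))
      isEdge : ∀ i → T (uncurry E (lookup edges i))
      isEdge i = proj₂ (∈-filter⁻ edge? {xs = cartesianProduct (allFin n) (allFin n)} (∈-lookup i))

    -- Every `f i` occurs at some index of `edges`, and looking up that index recovers `f i`.
    ≤-size : ∀ {m} (f : Fin m → Fin n × Fin n) → (∀ i → T (uncurry E (f i))) →
             Injective _≡_ _≡_ f → m ≤ size E
    ≤-size {m} f isEdge f-inj = subst (m ≤_) length-edges
      (injective⇒≤ {f = index ∘ f∈} λ {i} {j} eq → f-inj
        (trans (lookup-index (f∈ i)) (trans (cong (lookup edges) eq) (sym (lookup-index (f∈ j))))))
      where
      f∈ : ∀ i → f i ∈ edges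
      f∈ i = ∈-filter⁺ edge? (∈-cartesianProduct⁺ (∈-allFin _) (∈-allFin _)) (isEdge i)

-- The cyclic schedule of coordinates and the path that it prescribes.

module Schedule where

  open import Data.Nat using (ℕ; zero; suc; _+_; _*_; _≤_; _<_; _%_; NonZero; z≤n; s≤s)
  import Data.Nat as ℕ
  open import Data.Nat.Properties hiding (_≟_)
  open import Data.Nat.DivMod using (_mod_; [m+n]%n≡m%n; m<n⇒m%n≡m)
  import Data.Nat.Tactic.RingSolver as ℕRing
  open import Data.Integer using (-[1+_]; 0ℤ; +≤+)
  import Data.Integer as ℤ
  import Data.Integer.Properties as ℤₚ
  import Data.Integer.Tactic.RingSolver as ℤRing
  open import Data.Bool using (if_then_else_)
  open import Data.Fin using (Fin; zero; suc; toℕ; _≟_)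
  open import Data.Fin.Properties using (toℕ-injective; toℕ-fromℕ<; toℕ<n)
  open import Data.Product using (_×_; _,_)
  open import Data.Sum using ([_,_]′)
  open import Function using (_∘_; id)
  open import Relation.Nullary using (yes; no; does)
  open import Relation.Binary.PropositionalEquality

  dot : ∀ {k} → (Fin k → ℕ) → (Fin k → ℕ) → ℕ
  dot {zero}  a f = 0
  dot {suc k} a f = a zero * f zero + dot (a ∘ suc) (f ∘ suc)

  dot-cong : ∀ {k} (a : Fin k → ℕ) {f g} → f ≗ g → dot a f ≡ dot a g
  dot-cong {zero}  a f≗g = refl
  dot-cong {suc k} a f≗g = cong₂ _+_ (cong (a zero *_) (f≗g zero)) (dot-cong (a ∘ suc) (f≗g ∘ suc))

  -- The Kronecker delta, as a number, so that a step changing one coordinate is a single formula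
  -- valid at every coordinate.
  δ : ∀ {k} → Fin k → Fin k → ℕ
  δ c m = if does (c ≟ m) then 1 else 0

  δ-refl : ∀ {k} (c : Fin k) → δ c c ≡ 1
  δ-refl zero    = refl
  δ-refl (suc c) = δ-refl c

  δ≤1 : ∀ {k} (c m : Fin k) → δ c m ≤ 1
  δ≤1 c m with c ≟ m
  ... | yes _ = s≤s z≤n
  ... | no  _ = z≤n

  δ-* : ∀ {k} (a : Fin k → ℕ) c m → δ c m * a c ≡ δ c m * a m
  δ-* a c m with c ≟ m
  ... | yes refl = refl
  ... | no _     = refl

  dot-bump : ∀ {k} (a f : Fin k → ℕ) c b → dot a (λ m → f m + δ c m * b) ≡ dot a f + a c * b
  dot-bump {suc k} a f zero b = begin
    a zero * (f zero + 1 * b) + dot (a ∘ suc) (λ m → f (suc m) + 0)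
      ≡⟨ cong ((a zero * (f zero + 1 * b)) +_) (dot-cong (a ∘ suc) (λ m → +-identityʳ (f (suc m)))) ⟩
    a zero * (f zero + 1 * b) + dot (a ∘ suc) (f ∘ suc)
      ≡⟨ rearrange (a zero) (f zero) b _ ⟩
    a zero * f zero + dot (a ∘ suc) (f ∘ suc) + a zero * b ∎
    where
    open ≡-Reasoning
    rearrange : ∀ a f b d → a * (f + 1 * b) + d ≡ a * f + d + a * b
    rearrange = ℕRing.solve-∀
  dot-bump {suc k} a f (suc c) b = begin
    a zero * (f zero + 0) + dot (a ∘ suc) (λ m → f (suc m) + δ c m * b)
      ≡⟨ cong₂ _+_ (cong (a zero *_) (+-identityʳ (f zero))) (dot-bump (a ∘ suc) (f ∘ suc) c b) ⟩
    a zero * f zero + (dot (a ∘ suc) (f ∘ suc) + a (suc c) * b)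
      ≡⟨ +-assoc (a zero * f zero) _ _ ⟨
    a zero * f zero + dot (a ∘ suc) (f ∘ suc) + a (suc c) * b ∎
    where open ≡-Reasoning

  0≤z*z : ∀ z → 0ℤ ℤ.≤ z ℤ.* z
  0≤z*z (ℤ.+ n)    = subst (0ℤ ℤ.≤_) (ℤₚ.pos-* n n) (+≤+ z≤n)
  0≤z*z -[1+ n ] = +≤+ z≤n

  z*z≤0⇒z≡0 : ∀ z → z ℤ.* z ℤ.≤ 0ℤ → z ≡ 0ℤ
  z*z≤0⇒z≡0 z z²≤0 = [ id , id ]′ (ℤₚ.i*j≡0⇒i≡0∨j≡0 z (ℤₚ.≤-antisym z²≤0 (0≤z*z z)))

  -- The source of rigidity: where the potential does not grow, the square added to it vanishes,
  -- which forces the label of the edge.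
  ≤-cancel-square : ∀ p z → p ℤ.+ z ℤ.* z ℤ.≤ p → z ≡ 0ℤ
  ≤-cancel-square p z le = z*z≤0⇒z≡0 z (ℤₚ.≤-trans (ℤₚ.≤-reflexive (simpl p (z ℤ.* z))) (ℤₚ.i≤j⇒i-j≤0 le))
    where
    simpl : ∀ p s → s ≡ p ℤ.+ s ℤ.- p
    simpl = ℤRing.solve-∀

  -- Two points determine a line: subtracting the equations leaves the slopes multiplied by d - c,
  -- which is positive and cancels.
  affine-injective : ∀ {c d x x′ a a′} → c < d →
                     x + c * a ≡ x′ + c * a′ → x + d * a ≡ x′ + d * a′ → x ≡ x′ × a ≡ a′
  affine-injective {c} {d} {x} {x′} {a} {a′} c<d eqc eqd with m≤n⇒∃[o]m+o≡n c<d
  -- Writing d as `suc c + e` turns d - c into `suc e`, so no subtraction of naturals occurs.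
  ... | e , refl = +-cancelʳ-≡ (c * a) x x′ (trans eqc (cong (λ b → x′ + c * b) (sym a≡a′))) , a≡a′
    where
    split : ∀ x a → x + (suc c + e) * a ≡ x + c * a + suc e * a
    split = expand c e
      where
      expand : ∀ c e x a → x + (suc c + e) * a ≡ x + c * a + suc e * a
      expand = ℕRing.solve-∀
    a≡a′ : a ≡ a′
    a≡a′ = *-cancelˡ-≡ a a′ (suc e) (+-cancelˡ-≡ (x + c * a) _ _ (begin
      x + c * a + suc e * a    ≡⟨ split x a ⟨
      x + (suc c + e) * a      ≡⟨ eqd ⟩
      x′ + (suc c + e) * a′    ≡⟨ split x′ a′ ⟩
      x′ + c * a′ + suc e * a′ ≡⟨ cong (_+ suc e * a′) eqc ⟨
      x + c * a + suc e * a′   ∎))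
      where open ≡-Reasoning

  module _ {k : ℕ} .{{_ : NonZero k}} where

    active : ℕ → Fin k
    active t = t mod k

    active-+ : ∀ t → active (t + k) ≡ active t
    active-+ t = toℕ-injective (begin
      toℕ (active (t + k)) ≡⟨ toℕ-fromℕ< _ ⟩
      (t + k) % k          ≡⟨ [m+n]%n≡m%n t k ⟩
      t % k                ≡⟨ toℕ-fromℕ< _ ⟨
      toℕ (active t)       ∎)
      where open ≡-Reasoning

    active-toℕ : ∀ m → active (toℕ m) ≡ m
    active-toℕ m = toℕ-injective (trans (toℕ-fromℕ< _) (m<n⇒m%n≡m (toℕ<n m)))

    visits : ℕ → Fin k → ℕ
    visits zero    m = 0
    visits (suc t) m = visits t m + δ (active t) m

    visits-mono : ∀ m {i j} → i ≤ j → visits i m ≤ visits j m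
    visits-mono m {i} i≤j = go (≤⇒≤′ i≤j)
      where
      go : ∀ {j} → i ℕ.≤′ j → visits i m ≤ visits j m
      go ℕ.≤′-refl       = ≤-refl
      go (ℕ.≤′-step i≤j) = ≤-trans (go i≤j) (m≤m+n _ _)

    -- Any `k` consecutive layers activate each coordinate. In the window starting at 0 this happens
    -- in layer `toℕ m`; when the window moves by one, both counts gain the same summand because
    -- layers `i` and `i + k` have the same active coordinate.
    visits-period : ∀ m i → visits i m < visits (i + k) m
    visits-period m zero    = ≤-trans
      (≤-trans (≤-reflexive (sym (trans (cong (λ c → δ c m) (active-toℕ m)) (δ-refl m)))) (m≤n+m _ (visits (toℕ m) m)))
      (visits-mono m (toℕ<n m))
    visits-period m (suc i) rewrite active-+ i = +-monoˡ-< (δ (active i) m) (visits-period m i)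

    path : (x a : Fin k → ℕ) → ℕ → Fin k → ℕ
    path x a zero    m = x m
    path x a (suc t) m = path x a t m + δ (active t) m * a (active t)

    -- Each visit to `m` adds `a m`, by `δ-*`. This puts the path into the affine form that
    -- `affine-injective` needs, with the number of visits as argument.
    path-visits : ∀ x a t m → path x a t m ≡ x m + visits t m * a m
    path-visits x a zero    m = sym (+-identityʳ (x m))
    path-visits x a (suc t) m = begin
      path x a t m + δ (active t) m * a (active t)      ≡⟨ cong₂ _+_ (path-visits x a t m) (δ-* a (active t) m) ⟩
      x m + visits t m * a m + δ (active t) m * a m     ≡⟨ +-assoc (x m) _ _ ⟩
      x m + (visits t m * a m + δ (active t) m * a m)   ≡⟨ cong (x m +_) (*-distribʳ-+ (a m) (visits t m) _) ⟨
      x m + visits (suc t) m * a m                      ∎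
      where open ≡-Reasoning

    -- This sum of squares serves twice: as the height of the prescribed path and as the term of the
    -- potential that completes the square.
    climb : (Fin k → ℕ) → ℕ → ℕ
    climb a zero    = 0
    climb a (suc t) = climb a t + a (active t) * a (active t)

    -- A step with the prescribed label adds a square to the dot product, the same square that
    -- `climb` gains; hence the potential will be constant along the path.
    dot-path : ∀ x a t → dot a (path x a t) ≡ dot a x + climb a t
    dot-path x a zero    = sym (+-identityʳ _)
    dot-path x a (suc t) = begin
      dot a (path x a (suc t))                              ≡⟨ dot-bump a (path x a t) (active t) (a (active t)) ⟩
      dot a (path x a t) + a (active t) * a (active t)      ≡⟨ cong (_+ a (active t) * a (active t)) (dot-path x a t) ⟩
      dot a x + climb a t + a (active t) * a (active t)     ≡⟨ +-assoc (dot a x) _ _ ⟩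
      dot a x + climb a (suc t)                             ∎
      where open ≡-Reasoning

    path-bound : ∀ {X s x a} → (∀ m → x m < X) → (∀ m → a m < s) → ∀ t m → path x a t m < X + t * s
    path-bound {X} x<X a<s zero m = ≤-trans (x<X m) (m≤m+n X 0)
    path-bound {X} {s} {x} {a} x<X a<s (suc t) m = begin-strict
      path x a t m + δ (active t) m * a (active t)
        <⟨ +-mono-<-≤ (path-bound x<X a<s t m) (*-mono-≤ (δ≤1 (active t) m) (<⇒≤ (a<s (active t)))) ⟩
      X + t * s + 1 * s   ≡⟨ rearrange X t s ⟩
      X + suc t * s       ∎
      where
      open ≤-Reasoning
      rearrange : ∀ X t s → X + t * s + 1 * s ≡ X + suc t * s
      rearrange = ℕRing.solve-∀

    climb-bound : ∀ {s a} → (∀ m → a m < s) → ∀ t → climb a t ≤ t * (s * s)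
    climb-bound a<s zero = z≤n
    climb-bound {s} {a} a<s (suc t) = begin
      climb a t + a (active t) * a (active t)
        ≤⟨ +-mono-≤ (climb-bound a<s t) (*-mono-≤ (<⇒≤ (a<s _)) (<⇒≤ (a<s _))) ⟩
      t * (s * s) + s * s ≡⟨ +-comm _ (s * s) ⟩
      suc t * (s * s)     ∎
      where open ≤-Reasoning

-- The layered graph and its shortcuts.

module LayeredGraph where

  open import Defs
  open EdgeCount using (size-≤; ≤-size)
  open Schedule
  open import Data.Bool using (T)
  open import Data.Bool.Properties using (T-∨; T?)
  open import Data.Nat using (ℕ; zero; suc; _+_; _*_; _^_; _≤_; _<_; _≤?_; NonZero; z≤n)
  import Data.Nat as ℕ
  open import Data.Nat.Properties
  import Data.Nat.Tactic.RingSolver as ℕRing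
  open import Data.Integer using (ℤ; 0ℤ)
  import Data.Integer as ℤ
  import Data.Integer.Properties as ℤₚ
  import Data.Integer.Tactic.RingSolver as ℤRing
  open import Data.Fin using (Fin; zero; suc; toℕ; fromℕ<; finToFun; funToFin; combine)
  open import Data.Fin.Properties using (toℕ-injective; toℕ-fromℕ<; toℕ<n; *↔×; finToFun-funToFin; funToFin-finToFin; all?; any?; ¬∀⟶∃¬)
  open import Data.Product using (∃; ∃₂; _×_; _,_; proj₁; proj₂; uncurry)
  open import Data.Product.Function.NonDependent.Propositional using (_×-↔_)
  open import Data.Sum using (inj₁; inj₂)
  open import Function using (_∘_; Equivalence; Inverse; Injection; _↔_)
  open import Function.Construct.Composition using (_↔-∘_)
  open import Function.Construct.Identity using (↔-id)
  open import Function.Properties.Inverse using (↔⇒↣)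
  open import Relation.Nullary using (Dec; yes; no; ¬_; ⌊_⌋)
  open import Relation.Nullary.Decidable using (_×-dec_; toWitness; fromWitness)
  open import Relation.Binary.PropositionalEquality

  -- The increments b² of the height `h`, a² of the climb `A` and -2ab from the dot product `d` add
  -- up to (b - a)².
  complete-square : ∀ h A d b a →
    ℤ.+ (h + b * b + (A + a * a)) ℤ.- ℤ.+ (2 * (d + a * b)) ≡
    ℤ.+ (h + A) ℤ.- ℤ.+ (2 * d) ℤ.+ (ℤ.+ b ℤ.- ℤ.+ a) ℤ.* (ℤ.+ b ℤ.- ℤ.+ a)
  complete-square h A d b a = begin
    ℤ.+ (h + b * b + (A + a * a)) ℤ.- ℤ.+ (2 * (d + a * b))
      ≡⟨ cong₂ ℤ._-_
           (cong₂ (λ p r → ℤ.+ h ℤ.+ p ℤ.+ (ℤ.+ A ℤ.+ r)) (ℤₚ.pos-* b b) (ℤₚ.pos-* a a))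
           (trans (ℤₚ.pos-* 2 (d + a * b)) (cong (λ p → ℤ.+ 2 ℤ.* (ℤ.+ d ℤ.+ p)) (ℤₚ.pos-* a b))) ⟩
    ℤ.+ h ℤ.+ ℤ.+ b ℤ.* ℤ.+ b ℤ.+ (ℤ.+ A ℤ.+ ℤ.+ a ℤ.* ℤ.+ a) ℤ.- ℤ.+ 2 ℤ.* (ℤ.+ d ℤ.+ ℤ.+ a ℤ.* ℤ.+ b)
      ≡⟨ expand (ℤ.+ h) (ℤ.+ A) (ℤ.+ d) (ℤ.+ b) (ℤ.+ a) ⟩
    ℤ.+ h ℤ.+ ℤ.+ A ℤ.- ℤ.+ 2 ℤ.* ℤ.+ d ℤ.+ (ℤ.+ b ℤ.- ℤ.+ a) ℤ.* (ℤ.+ b ℤ.- ℤ.+ a)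
      ≡⟨ cong (λ p → ℤ.+ h ℤ.+ ℤ.+ A ℤ.- p ℤ.+ (ℤ.+ b ℤ.- ℤ.+ a) ℤ.* (ℤ.+ b ℤ.- ℤ.+ a)) (ℤₚ.pos-* 2 d) ⟨
    ℤ.+ (h + A) ℤ.- ℤ.+ (2 * d) ℤ.+ (ℤ.+ b ℤ.- ℤ.+ a) ℤ.* (ℤ.+ b ℤ.- ℤ.+ a) ∎
    where
    open ≡-Reasoning
    expand : ∀ h A d b a →
      h ℤ.+ b ℤ.* b ℤ.+ (A ℤ.+ a ℤ.* a) ℤ.- ℤ.+ 2 ℤ.* (d ℤ.+ a ℤ.* b) ≡
      h ℤ.+ A ℤ.- ℤ.+ 2 ℤ.* d ℤ.+ (b ℤ.- a) ℤ.* (b ℤ.- a)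
    expand = ℤRing.solve-∀

  finToFun-injective : ∀ {m k} {i j : Fin (m ^ k)} → finToFun {m} {k} i ≗ finToFun j → i ≡ j
  finToFun-injective {m} {k} {i} {j} eq = begin
    i                             ≡⟨ funToFin-finToFin {k} i ⟨
    funToFin (finToFun {m} {k} i) ≡⟨ funToFin-cong {k} eq ⟩
    funToFin (finToFun {m} {k} j) ≡⟨ funToFin-finToFin {k} j ⟩
    j                             ∎
    where
    open ≡-Reasoning
    funToFin-cong : ∀ {k m} {f g : Fin k → Fin m} → f ≗ g → funToFin f ≡ funToFin g
    funToFin-cong {zero}  f≗g = refl
    funToFin-cong {suc k} f≗g = cong₂ combine (f≗g zero) (funToFin-cong (f≗g ∘ suc))

  ∪-walk : ∀ {n} {G H : Graph n} {u v ℓ} → Walk G u v ℓ → Walk (G ∪ H) u v ℓ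
  ∪-walk here       = here
  ∪-walk (step e w) = step (Equivalence.from T-∨ (inj₁ e)) (∪-walk w)

  module Construction (k : ℕ) .{{_ : NonZero k}} (τ X Y s : ℕ) where

    n : ℕ
    n = τ * (X ^ k * (Y * s))

    Code : Set
    Code = Fin τ × Fin (X ^ k) × Fin Y × Fin s

    coding : Fin n ↔ Code
    coding = (↔-id (Fin τ) ×-↔ ((↔-id (Fin (X ^ k)) ×-↔ *↔×) ↔-∘ *↔×)) ↔-∘ *↔×

    open Inverse coding using () renaming (to to decode; from to encode)

    decode-encode : ∀ c → decode (encode c) ≡ c
    decode-encode = Inverse.strictlyInverseˡ coding

    encode-decode : ∀ u → encode (decode u) ≡ u
    encode-decode = Inverse.strictlyInverseʳ coding

    time : Fin n → ℕ
    time u = toℕ (proj₁ (decode u))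

    pos : Fin n → Fin k → ℕ
    pos u m = toℕ (finToFun {X} {k} (proj₁ (proj₂ (decode u))) m)

    height : Fin n → ℕ
    height u = toℕ (proj₁ (proj₂ (proj₂ (decode u))))

    pad : Fin n → ℕ
    pad u = toℕ (proj₂ (proj₂ (proj₂ (decode u))))

    vertex-≡ : ∀ {u v} → time u ≡ time v → pos u ≗ pos v → height u ≡ height v → pad u ≡ pad v → u ≡ v
    vertex-≡ {u} {v} t≡ x≡ y≡ z≡ = begin
      u                 ≡⟨ encode-decode u ⟨
      encode (decode u) ≡⟨ cong encode (cong₂ _,_ (toℕ-injective t≡)
                            (cong₂ _,_ (finToFun-injective (toℕ-injective ∘ x≡))
                            (cong₂ _,_ (toℕ-injective y≡) (toℕ-injective z≡)))) ⟩
      encode (decode v) ≡⟨ encode-decode v ⟩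
      v                 ∎
      where open ≡-Reasoning

    vertex : ∀ {t x y} → t < τ → (∀ m → x m < X) → y < Y → 0 < s →
             ∃ λ u → time u ≡ t × pos u ≗ x × height u ≡ y × pad u ≡ 0
    vertex {t} {x} {y} t<τ x<X y<Y 0<s =
      encode c
      , trans (cong (toℕ ∘ proj₁) eq) (toℕ-fromℕ< t<τ)
      , (λ m → trans (cong (λ c → toℕ (finToFun {X} {k} (proj₁ (proj₂ c)) m)) eq)
               (trans (cong toℕ (finToFun-funToFin (λ m → fromℕ< (x<X m)) m)) (toℕ-fromℕ< (x<X m))))
      , trans (cong (toℕ ∘ proj₁ ∘ proj₂ ∘ proj₂) eq) (toℕ-fromℕ< y<Y)
      , trans (cong (toℕ ∘ proj₂ ∘ proj₂ ∘ proj₂) eq) (toℕ-fromℕ< 0<s)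
      where
      c : Code
      c = fromℕ< t<τ , funToFin (λ m → fromℕ< (x<X m)) , fromℕ< y<Y , fromℕ< 0<s
      eq : decode (encode c) ≡ c
      eq = decode-encode c

    -- The equations are between natural numbers, so nothing wraps around: a label that would push a
    -- coordinate, the height or the layer out of its range gives no edge. Vertices with nonzero pad
    -- are isolated.
    record Step (u v : Fin n) (b : ℕ) : Set where
      constructor mkStep
      field
        pad-source  : pad u ≡ 0
        pad-target  : pad v ≡ 0
        time-step   : time v ≡ suc (time u)
        pos-step    : ∀ m → pos v m ≡ pos u m + δ (active (time u)) m * b
        height-step : height v ≡ height u + b * b
    open Step

    step? : ∀ u v b → Dec (Step u v b)
    step? u v b with (pad u ℕ.≟ 0) ×-dec (pad v ℕ.≟ 0) ×-dec (time v ℕ.≟ suc (time u))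
                     ×-dec all? (λ m → pos v m ℕ.≟ pos u m + δ (active (time u)) m * b)
                     ×-dec (height v ℕ.≟ height u + b * b)
    ... | yes (zu , zv , t , x , y) = yes (mkStep zu zv t x y)
    ... | no ¬p = no λ (mkStep zu zv t x y) → ¬p (zu , zv , t , x , y)

    G : Graph n
    G u v = ⌊ any? (λ (b : Fin s) → step? u v (toℕ b)) ⌋

    edge⇒step : ∀ {u v} → T (G u v) → ∃ λ (b : Fin s) → Step u v (toℕ b)
    edge⇒step = toWitness

    step⇒edge : ∀ {u v b} → b < s → Step u v b → T (G u v)
    step⇒edge {u} {v} b<s st = fromWitness (fromℕ< b<s , subst (Step u v) (sym (toℕ-fromℕ< b<s)) st)

    retag : Fin n → Fin s → Fin n
    retag u b = encode (proj₁ (decode u) , proj₁ (proj₂ (decode u)) , proj₁ (proj₂ (proj₂ (decode u))) , b)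

    step-unique : ∀ {u v v′ b} → Step u v b → Step u v′ b → v ≡ v′
    step-unique S S′ = vertex-≡
      (trans (time-step S) (sym (time-step S′)))
      (λ m → trans (pos-step S m) (sym (pos-step S′ m)))
      (trans (height-step S) (sym (height-step S′)))
      (trans (pad-target S) (sym (pad-target S′)))

    -- An edge is determined by its source and its label b < s, and sources
    -- have pad 0, so storing b in the pad embeds the edges into the vertices.
    size-G : size G ≤ n
    size-G = size-≤ G (λ u v e → retag u (proj₁ (edge⇒step e))) inj
      where
      inj : ∀ {u v u′ v′} (e : T (G u v)) (e′ : T (G u′ v′)) →
            retag u (proj₁ (edge⇒step e)) ≡ retag u′ (proj₁ (edge⇒step e′)) → (u , v) ≡ (u′ , v′)
      inj {u} {v} {u′} {v′} e e′ eq = determined (edge⇒step e) (edge⇒step e′) eq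
        where
        determined : ((b , _) : ∃ λ (b : Fin s) → Step u v (toℕ b)) ((b′ , _) : ∃ λ (b′ : Fin s) → Step u′ v′ (toℕ b′)) →
                     retag u b ≡ retag u′ b′ → (u , v) ≡ (u′ , v′)
        determined (b , S) (b′ , S′) eq = cong₂ _,_ u≡u′
          (step-unique (subst₂ (λ w c → Step w v (toℕ c)) u≡u′ b≡b′ S) S′)
          where
          c≡ = trans (sym (decode-encode _)) (trans (cong decode eq) (decode-encode _))
          b≡b′ : b ≡ b′
          b≡b′ = cong (proj₂ ∘ proj₂ ∘ proj₂) c≡
          u≡u′ : u ≡ u′
          u≡u′ = vertex-≡ {u} {u′} (cong (toℕ ∘ proj₁) c≡)
            (λ m → cong (λ c → toℕ (finToFun {X} {k} (proj₁ (proj₂ c)) m)) c≡)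
            (cong (toℕ ∘ proj₁ ∘ proj₂ ∘ proj₂) c≡)
            (trans (pad-source S) (sym (pad-source S′)))

    -- The potential, and the paths on which it is constant.

    potential : (Fin k → ℕ) → Fin n → ℤ
    potential a u = ℤ.+ (height u + climb a (time u)) ℤ.- ℤ.+ (2 * dot a (pos u))

    potential-step : ∀ {u v b} a → Step u v b →
      let z = ℤ.+ b ℤ.- ℤ.+ a (active (time u)) in
      potential a v ≡ potential a u ℤ.+ z ℤ.* z
    potential-step {u} {v} {b} a S = begin
      potential a v
        ≡⟨ cong₂ (λ h d → ℤ.+ h ℤ.- ℤ.+ (2 * d))
             (cong₂ _+_ (height-step S) (cong (climb a) (time-step S)))
             (trans (dot-cong a (pos-step S)) (dot-bump a (pos u) c b)) ⟩
      ℤ.+ (height u + b * b + (climb a (time u) + a c * a c)) ℤ.- ℤ.+ (2 * (dot a (pos u) + a c * b))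
        ≡⟨ complete-square (height u) (climb a (time u)) (dot a (pos u)) b (a c) ⟩
      potential a u ℤ.+ (ℤ.+ b ℤ.- ℤ.+ a c) ℤ.* (ℤ.+ b ℤ.- ℤ.+ a c) ∎
      where
      open ≡-Reasoning
      c = active (time u)

    potential-edge : ∀ a {u v} → T (G u v) → potential a u ℤ.≤ potential a v
    potential-edge a {u} {v} e with edge⇒step e
    ... | b , S = subst (potential a u ℤ.≤_) (sym (potential-step a S)) (begin
      potential a u              ≡⟨ ℤₚ.+-identityʳ _ ⟨
      potential a u ℤ.+ 0ℤ       ≤⟨ ℤₚ.+-monoʳ-≤ (potential a u) (0≤z*z z) ⟩
      potential a u ℤ.+ z ℤ.* z  ∎)
      where
      open ℤₚ.≤-Reasoning
      z = ℤ.+ toℕ b ℤ.- ℤ.+ a (active (time u))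

    potential-walk : ∀ a {u v ℓ} → Walk G u v ℓ → potential a u ℤ.≤ potential a v
    potential-walk a here       = ℤₚ.≤-refl
    potential-walk a (step e w) = ℤₚ.≤-trans (potential-edge a e) (potential-walk a w)

    -- The vertices of the path prescribed by `x` and `a`, starting at height 0. The layer is read
    -- off from `u` itself, so being on the path is one decidable condition on a vertex.
    record On (x a : Fin k → ℕ) (u : Fin n) : Set where
      constructor mkOn
      field
        pad-on    : pad u ≡ 0
        pos-on    : pos u ≗ path x a (time u)
        height-on : height u ≡ climb a (time u)
    open On

    on? : ∀ x a u → Dec (On x a u)
    on? x a u with (pad u ℕ.≟ 0) ×-dec all? (λ m → pos u m ℕ.≟ path x a (time u) m)
                   ×-dec (height u ℕ.≟ climb a (time u))
    ... | yes (z , p , h) = yes (mkOn z p h)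
    ... | no ¬p = no λ (mkOn z p h) → ¬p (z , p , h)

    on-unique : ∀ {x a u v} → On x a u → On x a v → time u ≡ time v → u ≡ v
    on-unique {x} {a} {u} {v} Ou Ov t≡ = vertex-≡ t≡
      (λ m → trans (pos-on Ou m) (trans (cong (λ t → path x a t m) t≡) (sym (pos-on Ov m))))
      (trans (height-on Ou) (trans (cong (climb a) t≡) (sym (height-on Ov))))
      (trans (pad-on Ou) (sym (pad-on Ov)))

    on-step : ∀ {x a u v} → On x a u → On x a v → time v ≡ suc (time u) → Step u v (a (active (time u)))
    on-step {x} {a} {u} {v} Ou Ov t≡ = mkStep (pad-on Ou) (pad-on Ov) t≡
      (λ m → trans (pos-on Ov m) (trans (cong (λ t → path x a t m) t≡)
               (cong (_+ δ (active (time u)) m * a (active (time u))) (sym (pos-on Ou m)))))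
      (trans (height-on Ov) (trans (cong (climb a) t≡)
               (cong (_+ a (active (time u)) * a (active (time u))) (sym (height-on Ou)))))

    step-on : ∀ {x a u v} → On x a u → Step u v (a (active (time u))) → On x a v
    step-on {x} {a} {u} {v} Ou S = mkOn (pad-target S)
      (λ m → trans (pos-step S m) (trans (cong (_+ δ (active (time u)) m * a (active (time u))) (pos-on Ou m))
               (cong (λ t → path x a t m) (sym (time-step S)))))
      (trans (height-step S) (trans (cong (_+ a (active (time u)) * a (active (time u))) (height-on Ou))
               (cong (climb a) (sym (time-step S)))))

    -- The height and the correction term each contribute `A`, while the dot product has grown by
    -- `A` and enters with factor -2. The growth cancels, leaving a value independent of the layer.
    potential-on : ∀ {x a u} → On x a u → potential a u ≡ ℤ.- (ℤ.+ (2 * dot a x))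
    potential-on {x} {a} {u} Ou = begin
      potential a u
        ≡⟨ cong₂ (λ h d → ℤ.+ (h + A) ℤ.- ℤ.+ (2 * d)) (height-on Ou)
             (trans (dot-cong a (pos-on Ou)) (dot-path x a (time u))) ⟩
      ℤ.+ (A + A) ℤ.- ℤ.+ (2 * (dot a x + A))
        ≡⟨ cong (λ p → ℤ.+ (A + A) ℤ.- ℤ.+ p) (double (dot a x) A) ⟩
      ℤ.+ (A + A) ℤ.- (ℤ.+ (A + A) ℤ.+ ℤ.+ (2 * dot a x))
        ≡⟨ cancel (ℤ.+ (A + A)) (ℤ.+ (2 * dot a x)) ⟩
      ℤ.- (ℤ.+ (2 * dot a x)) ∎
      where
      open ≡-Reasoning
      A = climb a (time u)
      double : ∀ d A → 2 * (d + A) ≡ A + A + 2 * d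
      double = ℕRing.solve-∀
      cancel : ∀ p q → p ℤ.- (p ℤ.+ q) ≡ ℤ.- q
      cancel = ℤRing.solve-∀

    -- The square in `potential-step` has to vanish, so the edge carries the prescribed label and
    -- follows the path.
    edge-on : ∀ {x a u v} → On x a u → T (G u v) → potential a v ℤ.≤ potential a u → On x a v
    edge-on {x} {a} {u} {v} Ou e le with edge⇒step e
    ... | b , S = step-on Ou (subst (Step u v) b≡a S)
      where
      b≡a : toℕ b ≡ a (active (time u))
      b≡a = ℤₚ.+-injective (ℤₚ.i-j≡0⇒i≡j _ _
              (≤-cancel-square (potential a u) _ (subst (ℤ._≤ potential a u) (potential-step a S) le)))

    -- The potential never decreases along a walk, and here it ends no higher than it began, so
    -- `edge-on` applies to every edge in turn. Applied to the walk behind a shortcut, this puts the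
    -- far end of the shortcut on the path.
    walk-on : ∀ {x a u v ℓ} → On x a u → Walk G u v ℓ → potential a v ℤ.≤ potential a u → On x a v
    walk-on Ou here le = Ou
    walk-on {x} {a} {u} {w} Ou (step {v = v} e p) le =
      walk-on Ov p (ℤₚ.≤-trans le (potential-edge a e))
      where
      Ov : On x a v
      Ov = edge-on Ou e (ℤₚ.≤-trans (potential-walk a p) le)

    -- Between layers at least `k` apart every coordinate is visited, so the two common vertices
    -- give, for each coordinate, two distinct points of the same line.
    on-injective : ∀ {x a x′ a′ u v} → On x a u → On x′ a′ u → On x a v → On x′ a′ v →
                   time u + k ≤ time v → x ≗ x′ × a ≗ a′
    on-injective {x} {a} {x′} {a′} {u} {v} Ou Ou′ Ov Ov′ far = proj₁ ∘ both , proj₂ ∘ both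
      where
      meet : ∀ {w} → On x a w → On x′ a′ w → ∀ m →
             x m + visits (time w) m * a m ≡ x′ m + visits (time w) m * a′ m
      meet {w} O O′ m = trans (sym (path-visits x a (time w) m))
        (trans (trans (sym (pos-on O m)) (pos-on O′ m)) (path-visits x′ a′ (time w) m))
      both : ∀ m → x m ≡ x′ m × a m ≡ a′ m
      both m = affine-injective (<-≤-trans (visits-period m (time u)) (visits-mono m far))
                 (meet Ou Ou′ m) (meet Ov Ov′ m)

    LongShortcut : Graph n → (x a : Fin k → ℕ) → Fin n × Fin n → Set
    LongShortcut H x a (u , v) = On x a u × On x a v × T (H u v) × time u + k ≤ time v

    -- Walks that may use shortcuts.

    module _ {H : Graph n} (H-shortcut : ShortcutSet G H) where

      -- A shortcut stands for a walk in `G`, so it cannot lower the potential either.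
      potential-∪-walk : ∀ a {u v ℓ} → Walk (G ∪ H) u v ℓ → potential a u ℤ.≤ potential a v
      potential-∪-walk a here = ℤₚ.≤-refl
      potential-∪-walk a (step {u} {v} e w) with Equivalence.to T-∨ e
      ... | inj₁ g = ℤₚ.≤-trans (potential-edge a g) (potential-∪-walk a w)
      ... | inj₂ h = ℤₚ.≤-trans (potential-walk a (proj₂ (proj₂ (H-shortcut u v h)))) (potential-∪-walk a w)

      -- The bound on the potential keeps every vertex of the walk on the path. Each step then
      -- advances at most `k` layers: an edge advances one, and a shortcut advancing more would be
      -- long.
      slow-walk : ∀ {x a u v ℓ} → (∀ e → ¬ LongShortcut H x a e) → On x a u → Walk (G ∪ H) u v ℓ →
                  potential a v ℤ.≤ potential a u → time v ≤ time u + ℓ * k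
      slow-walk none Ou here le = m≤m+n _ 0
      slow-walk {x} {a} {u} {w} none Ou (step {v = v} {k = ℓ} e p) le = begin
        time w                  ≤⟨ slow-walk none Ov p v-le ⟩
        time v + ℓ * k          ≤⟨ +-monoˡ-≤ (ℓ * k) short ⟩
        time u + k + ℓ * k      ≡⟨ +-assoc (time u) k _ ⟩
        time u + suc ℓ * k      ∎
        where
        open ≤-Reasoning
        v≤u : potential a v ℤ.≤ potential a u
        v≤u = ℤₚ.≤-trans (potential-∪-walk a p) le
        advance : On x a v × time v ≤ time u + k
        advance with Equivalence.to T-∨ e
        ... | inj₁ g = edge-on Ou g v≤u , ≤-trans
                (≤-reflexive (trans (time-step (proj₂ (edge⇒step g))) (+-comm 1 (time u))))
                (+-monoʳ-≤ (time u) (ℕ.>-nonZero⁻¹ k))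
        ... | inj₂ h = Ov , ≰⇒≥ (λ far → none (u , v) (Ou , Ov , h , far))
          where
          Ov : On x a v
          Ov = walk-on Ou (proj₂ (proj₂ (H-shortcut u v h))) v≤u
        Ov = proj₁ advance
        short = proj₂ advance
        -- The potential has the same value at `u` and `v`, both on the path, so the bound passes to
        -- the rest of the walk.
        v-le : potential a w ℤ.≤ potential a v
        v-le = subst (potential a w ℤ.≤_) (trans (potential-on Ou) (sym (potential-on Ov))) le

    -- Pigeonhole on the pairs of a start and a slope.

    Pairs : ℕ → ℕ
    Pairs X₀ = X₀ ^ k * s ^ k

    module _ {X₀ : ℕ} where

      start : Fin (Pairs X₀) → Fin k → ℕ
      start p m = toℕ (finToFun {X₀} {k} (proj₁ (Inverse.to (*↔× {X₀ ^ k} {s ^ k}) p)) m)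

      slope : Fin (Pairs X₀) → Fin k → ℕ
      slope p m = toℕ (finToFun {s} {k} (proj₂ (Inverse.to (*↔× {X₀ ^ k} {s ^ k}) p)) m)

      pair-≡ : ∀ {p p′} → start p ≗ start p′ → slope p ≗ slope p′ → p ≡ p′
      pair-≡ x≗ a≗ = Injection.injective (↔⇒↣ (*↔× {X₀ ^ k} {s ^ k})) (cong₂ _,_
        (finToFun-injective (toℕ-injective ∘ x≗)) (finToFun-injective (toℕ-injective ∘ a≗)))

    module _ {q X₀ : ℕ} (q<τ : q < τ) (X-fits : X₀ + q * s ≤ X) (Y-fits : q * (s * s) < Y) where

      -- Starts are confined below `X₀` rather than `X` to leave room for growth; the three range
      -- conditions keep the path inside the vertex set through layer `q`.
      on-time : ∀ {x a} → (∀ m → x m < X₀) → (∀ m → a m < s) → ∀ {t} → t ≤ q →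
                ∃ λ u → On x a u × time u ≡ t
      on-time {x} {a} x<X₀ a<s {t} t≤q
        with vertex {x = path x a t} (≤-<-trans t≤q q<τ)
               (λ m → <-≤-trans (path-bound x<X₀ a<s t m) (≤-trans (+-monoʳ-≤ X₀ (*-monoˡ-≤ s t≤q)) X-fits))
               (≤-<-trans (≤-trans (climb-bound a<s t) (*-monoˡ-≤ (s * s) t≤q)) Y-fits)
               -- Any label below `s` shows that `s` is positive, so pad 0 exists.
               (≤-<-trans z≤n (a<s (active t)))
      ... | u , refl , p , h , z = u , mkOn z p h , refl

      -- Ending in layer `q` bounds the layer of each intermediate vertex, so that `on-time`
      -- supplies it.
      on-reachable : ∀ {x a} → (∀ m → x m < X₀) → (∀ m → a m < s) →
                     ∀ d {u v} → On x a u → On x a v → time u + d ≡ time v → time v ≡ q → Reachable G u v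
      on-reachable x<X₀ a<s zero {u} Ou Ov t≡ _ =
        0 , subst (λ v → Walk G u v 0) (on-unique Ou Ov (trans (sym (+-identityʳ (time u))) t≡)) here
      on-reachable x<X₀ a<s (suc d) {u} {v} Ou Ov t≡ v≡q =
        suc (proj₁ rest) , step (step⇒edge (a<s _) (on-step Ou Ow w≡)) (proj₂ rest)
        where
        t≡′ : suc (time u) + d ≡ time v
        t≡′ = trans (sym (+-suc (time u) d)) t≡
        next = on-time x<X₀ a<s (≤-trans (m≤m+n (suc (time u)) d) (≤-reflexive (trans t≡′ v≡q)))
        Ow   = proj₁ (proj₂ next)
        w≡   = proj₂ (proj₂ next)
        rest = on-reachable x<X₀ a<s d Ow Ov (trans (cong (_+ d) w≡) t≡′) v≡q

      -- Some pair has a path without long shortcuts. The vertices of that path in layers 0 and `q`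
      -- have equal potential, so `slow-walk` applies to every walk between them.
      far-pair : ∀ {H} → ShortcutSet G H → size H < Pairs X₀ →
                 ∃₂ λ u v → Reachable (G ∪ H) u v × (∀ ℓ → Walk (G ∪ H) u v ℓ → q ≤ ℓ * k)
      far-pair {H} H-shortcut H-small = u , v ,
        (proj₁ reach , ∪-walk (proj₂ reach)) ,
        λ ℓ w → subst₂ (λ i j → i ≤ j + ℓ * k) tv tu
          (slow-walk H-shortcut (λ (e , f) le → proj₂ good (e , f , le)) Ou w
            (ℤₚ.≤-reflexive (trans (potential-on Ov) (sym (potential-on Ou)))))
        where
        Bad : Fin (Pairs X₀) → Set
        Bad p = ∃₂ λ u v → LongShortcut H (start p) (slope p) (u , v)

        -- Decidability lets the refutation of "all pairs are bad" produce an actual good pair.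
        bad? : ∀ p → Dec (Bad p)
        bad? p = any? λ u → any? λ v → on? (start p) (slope p) u ×-dec on? (start p) (slope p) v
                   ×-dec T? (H u v) ×-dec (time u + k ≤? time v)

        -- Otherwise choosing a long shortcut on each of the paths injects the pairs into H.
        not-all-bad : ¬ (∀ p → Bad p)
        not-all-bad bad = <⇒≱ H-small (≤-size H
          (λ p → proj₁ (bad p) , proj₁ (proj₂ (bad p)))
          (λ p → proj₁ (proj₂ (proj₂ (proj₂ (proj₂ (bad p))))))
          inj)
          where
          inj : ∀ {p p′} → (proj₁ (bad p) , proj₁ (proj₂ (bad p))) ≡ (proj₁ (bad p′) , proj₁ (proj₂ (bad p′))) → p ≡ p′
          inj {p} {p′} eq with bad p | bad p′
          inj refl | u , v , Ou , Ov , _ , far | .u , .v , Ou′ , Ov′ , _ =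
            uncurry pair-≡ (on-injective Ou Ou′ Ov Ov′ far)

        good : ∃ λ p → ¬ Bad p
        good = ¬∀⟶∃¬ (Pairs X₀) Bad bad? not-all-bad

        x<X₀ : ∀ m → start (proj₁ good) m < X₀
        x<X₀ m = toℕ<n _
        a<s : ∀ m → slope (proj₁ good) m < s
        a<s m = toℕ<n _

        source = on-time x<X₀ a<s {0} z≤n
        target = on-time x<X₀ a<s {q} ≤-refl
        u  = proj₁ source
        Ou = proj₁ (proj₂ source)
        tu = proj₂ (proj₂ source)
        v  = proj₁ target
        Ov = proj₁ (proj₂ target)
        tv = proj₂ (proj₂ target)
        reach = on-reachable x<X₀ a<s q Ou Ov (trans (cong (_+ q) tu) (sym tv)) tv

-- Translating rational inequalities into inequalities between natural powers.

open import Defs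
open LayeredGraph using (module Construction)
open import Data.Nat using (ℕ; zero; suc; _<_; NonZero; z≤n; s≤s)
open import Data.Nat as ℕ using ()
import Data.Nat.Properties as ℕₚ
import Data.Nat.Tactic.RingSolver as ℕRing
open import Data.Nat.Coprimality using (1-coprimeTo; sym)
open import Data.Integer using (-[1+_]; +≤+)
import Data.Integer as ℤ
import Data.Integer.Properties as ℤₚ
open import Data.Rational using (ℚ; mkℚ; 0ℚ; 1ℚ; _/_; _*_; _-_; _>_; _≤_; ↥_; ↧ₙ_; 1/_; NonNegative; nonNegative; *≤*)
import Data.Rational as ℚ
open import Data.Rational.Properties
open import Data.Product using (Σ; _×_; _,_)
open import Relation.Binary.PropositionalEquality hiding (sym)
import Relation.Binary.PropositionalEquality as ≡
open import Algebra.Bundles using (CommutativeMonoid)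
open import Algebra.Properties.CommutativeSemigroup (CommutativeMonoid.commutativeSemigroup *-1-commutativeMonoid) using (interchange)

-- The same number as `toℚ n` with visible numerator and denominator; the gcd in `_/_` does not
-- reduce for a variable `n`.
integerℚ : ℕ → ℚ
integerℚ n = mkℚ (ℤ.+ n) 0 (sym (1-coprimeTo n))

toℚ≡integerℚ : ∀ n → toℚ n ≡ integerℚ n
toℚ≡integerℚ n = normalize-coprime (sym (1-coprimeTo n))

toℚ-mono : ∀ {m n} → m ℕ.≤ n → toℚ m ≤ toℚ n
toℚ-mono {m} {n} m≤n = subst₂ _≤_ (≡.sym (toℚ≡integerℚ m)) (≡.sym (toℚ≡integerℚ n))
  (*≤* (ℤₚ.*-monoʳ-≤-nonNeg (ℤ.+ 1) (+≤+ m≤n)))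

toℚ-cancel : ∀ {m n} → toℚ m ≤ toℚ n → m ℕ.≤ n
toℚ-cancel {m} {n} le = ℤₚ.drop‿+≤+ (ℤₚ.*-cancelʳ-≤-pos (ℤ.+ m) (ℤ.+ n) (ℤ.+ 1)
  (drop-*≤* (subst₂ _≤_ (toℚ≡integerℚ m) (toℚ≡integerℚ n) le)))

toℚ-* : ∀ m n → toℚ (m ℕ.* n) ≡ toℚ m * toℚ n
toℚ-* m n = ≡.trans (cong (_/ 1) (ℤₚ.pos-* m n)) (≡.sym (cong₂ _*_ (toℚ≡integerℚ m) (toℚ≡integerℚ n)))

toℚ-^ : ∀ m k → toℚ (m ℕ.^ k) ≡ toℚ m ^ℚ k
toℚ-^ m zero    = refl
toℚ-^ m (suc k) = ≡.trans (toℚ-* m (m ℕ.^ k)) (cong (toℚ m *_) (toℚ-^ m k))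

toℚ-nonNeg : ∀ n → NonNegative (toℚ n)
toℚ-nonNeg n = normalize-nonNeg n 1

^ℚ-nonNeg : ∀ p .{{_ : NonNegative p}} k → NonNegative (p ^ℚ k)
^ℚ-nonNeg p zero    = _
^ℚ-nonNeg p (suc k) = nonNeg*nonNeg⇒nonNeg p (p ^ℚ k) {{^ℚ-nonNeg p k}}

^ℚ-mono-≤ : ∀ {p q} .{{_ : NonNegative p}} .{{_ : NonNegative q}} → p ≤ q → ∀ k → p ^ℚ k ≤ q ^ℚ k
^ℚ-mono-≤ p≤q zero = ≤-refl
^ℚ-mono-≤ {p} {q} p≤q (suc k) = ≤-trans
  (*-monoʳ-≤-nonNeg (p ^ℚ k) {{^ℚ-nonNeg p k}} p≤q)
  (*-monoˡ-≤-nonNeg q (^ℚ-mono-≤ p≤q k))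

^ℚ-distribʳ-* : ∀ p q k → (p * q) ^ℚ k ≡ p ^ℚ k * q ^ℚ k
^ℚ-distribʳ-* p q zero    = refl
^ℚ-distribʳ-* p q (suc k) = ≡.trans (cong (p * q *_) (^ℚ-distribʳ-* p q k)) (interchange p q (p ^ℚ k) (q ^ℚ k))

-- The denominator is at least 1. This gives the natural number that dominates `C` in the choice of
-- `q`.
≤-numerator : ∀ p → p > 0ℚ → p ≤ toℚ ℤ.∣ ↥ p ∣
≤-numerator p@(mkℚ (ℤ.+ a) d _) _ = subst (p ≤_) (≡.sym (toℚ≡integerℚ a))
  (*≤* (ℤₚ.*-monoˡ-≤-nonNeg (ℤ.+ a) (+≤+ (s≤s z≤n))))
≤-numerator (mkℚ -[1+ _ ] _ _) (ℚ.*<* ())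

-- Since e < 2 has denominator b, n^e ≤ n^(2 − 1/b); a factor n is moved to the left to avoid 2b ∸ 1.
atMost⇒≤ : ∀ {x C q n e} → C > 0ℚ → C ≤ toℚ q → e ℚ.< toℚ 2 → 0 < n → AtMostCPow x C n e →
           x ℕ.^ ↧ₙ e ℕ.* n ℕ.≤ q ℕ.^ ↧ₙ e ℕ.* n ℕ.^ (2 ℕ.* ↧ₙ e)
atMost⇒≤ {x} {C} {q} {n} {e@(mkℚ (ℤ.+ m) b-1 _)} C>0 C≤q (ℚ.*<* e<2) 0<n x≤ = begin
  x ℕ.^ b ℕ.* n                   ≤⟨ ℕₚ.*-monoˡ-≤ n (toℚ-cancel {x ℕ.^ b} {q ℕ.^ b ℕ.* n ℕ.^ m}
                                      (≤-trans (≤-reflexive (toℚ-^ x b)) (≤-trans x≤ Cn≤))) ⟩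
  q ℕ.^ b ℕ.* n ℕ.^ m ℕ.* n       ≡⟨ ℕₚ.*-assoc (q ℕ.^ b) _ n ⟩
  q ℕ.^ b ℕ.* (n ℕ.^ m ℕ.* n)     ≡⟨ cong (q ℕ.^ b ℕ.*_) (ℕₚ.*-comm (n ℕ.^ m) n) ⟩
  q ℕ.^ b ℕ.* n ℕ.^ suc m         ≤⟨ ℕₚ.*-monoʳ-≤ (q ℕ.^ b) (ℕₚ.^-monoʳ-≤ n {{ℕ.>-nonZero 0<n}} m<2b) ⟩
  q ℕ.^ b ℕ.* n ℕ.^ (2 ℕ.* b)     ∎
  where
  open ℕₚ.≤-Reasoning
  b = suc b-1
  m<2b : m < 2 ℕ.* b
  m<2b = ℤₚ.drop‿+<+ (subst₂ ℤ._<_ (ℤₚ.*-identityʳ (ℤ.+ m)) (≡.sym (ℤₚ.pos-* 2 b)) e<2)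
  Cn≤ : (C ^ℚ b) * toℚ (n ℕ.^ m) ≤ toℚ (q ℕ.^ b ℕ.* n ℕ.^ m)
  Cn≤ = ≤-trans
    (*-monoʳ-≤-nonNeg (toℚ (n ℕ.^ m)) {{toℚ-nonNeg (n ℕ.^ m)}} (^ℚ-mono-≤ {{nonNegative (<⇒≤ C>0)}} {{toℚ-nonNeg q}} C≤q b))
    (≤-reflexive (≡.trans (cong (_* toℚ (n ℕ.^ m)) (≡.sym (toℚ-^ q b))) (≡.sym (toℚ-* (q ℕ.^ b) (n ℕ.^ m)))))
atMost⇒≤ {x} {C} {q} {n} {e@(mkℚ -[1+ m ] b-1 _)} C>0 C≤q e<2 0<n x≤ = begin
  x ℕ.^ b ℕ.* n                 ≤⟨ ℕₚ.*-monoʳ-≤ (x ℕ.^ b) (ℕₚ.m≤m*n n (n ℕ.^ m) {{ℕₚ.m^n≢0 n m}}) ⟩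
  x ℕ.^ b ℕ.* n ℕ.^ suc m       ≤⟨ toℚ-cancel {x ℕ.^ b ℕ.* n ℕ.^ suc m} {q ℕ.^ b} (≤-trans (≤-reflexive xn≡) (≤-trans x≤ C≤)) ⟩
  q ℕ.^ b                       ≤⟨ ℕₚ.m≤m*n (q ℕ.^ b) (n ℕ.^ (2 ℕ.* b)) {{ℕₚ.m^n≢0 n (2 ℕ.* b)}} ⟩
  q ℕ.^ b ℕ.* n ℕ.^ (2 ℕ.* b)   ∎
  where
  open ℕₚ.≤-Reasoning
  b = suc b-1
  instance
    n≢0 : NonZero n
    n≢0 = ℕ.>-nonZero 0<n
  xn≡ : toℚ (x ℕ.^ b ℕ.* n ℕ.^ suc m) ≡ (toℚ x ^ℚ b) * toℚ (n ℕ.^ suc m)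
  xn≡ = ≡.trans (toℚ-* (x ℕ.^ b) (n ℕ.^ suc m)) (cong (_* toℚ (n ℕ.^ suc m)) (toℚ-^ x b))
  C≤ : (C ^ℚ b) ≤ toℚ (q ℕ.^ b)
  C≤ = ≤-trans (^ℚ-mono-≤ {{nonNegative (<⇒≤ C>0)}} {{toℚ-nonNeg q}} C≤q b) (≤-reflexive (≡.sym (toℚ-^ q b)))

reciprocal-bound : ∀ {k-1 q ℓ} → q ℕ.≤ ℓ ℕ.* suc k-1 → 1/ integerℚ (suc k-1) * toℚ q ≤ toℚ ℓ
reciprocal-bound {k-1} {q} {ℓ} q≤ = begin
  r * toℚ q                     ≤⟨ *-monoˡ-≤-nonNeg r (toℚ-mono q≤) ⟩
  r * toℚ (ℓ ℕ.* k)             ≡⟨ cong (r *_) (≡.trans (toℚ-* ℓ k) (*-comm (toℚ ℓ) (toℚ k))) ⟩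
  r * (toℚ k * toℚ ℓ)           ≡⟨ *-assoc r (toℚ k) (toℚ ℓ) ⟨
  r * toℚ k * toℚ ℓ             ≡⟨ cong (λ p → r * p * toℚ ℓ) (toℚ≡integerℚ k) ⟩
  r * integerℚ k * toℚ ℓ        ≡⟨ cong (_* toℚ ℓ) (*-inverseˡ (integerℚ k)) ⟩
  1ℚ * toℚ ℓ                    ≡⟨ *-identityˡ (toℚ ℓ) ⟩
  toℚ ℓ                         ∎
  where
  open ≤-Reasoning
  k = suc k-1
  r = 1/ integerℚ k

-- The exponent 1/(d + 1) turns n = q^(d + 1) back into `q`, so the claim is the hypothesis raised
-- to the power d + 1.
atLeast-root : ∀ {c q n ℓ d} .{{_ : NonNegative c}} → n ≡ q ℕ.^ suc d → c * toℚ q ≤ toℚ ℓ →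
               AtLeastCPow ℓ c n (mkℚ (ℤ.+ 1) d (1-coprimeTo (suc d)))
atLeast-root {c} {q} {n} {ℓ} {d} n≡ cq≤ℓ = begin
  (c ^ℚ D) * toℚ (n ℕ.^ 1)      ≡⟨ cong (λ m → (c ^ℚ D) * toℚ m) (≡.trans (ℕₚ.^-identityʳ n) n≡) ⟩
  (c ^ℚ D) * toℚ (q ℕ.^ D)      ≡⟨ cong ((c ^ℚ D) *_) (toℚ-^ q D) ⟩
  (c ^ℚ D) * (toℚ q ^ℚ D)       ≡⟨ ^ℚ-distribʳ-* c (toℚ q) D ⟨
  (c * toℚ q) ^ℚ D              ≤⟨ ^ℚ-mono-≤ {{nonNeg*nonNeg⇒nonNeg c (toℚ q) {{toℚ-nonNeg q}}}} {{toℚ-nonNeg ℓ}} cq≤ℓ D ⟩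
  toℚ ℓ ^ℚ D                    ∎
  where
  open ≤-Reasoning
  D = suc d

-- Choice of the ranges and comparison of exponents.

module Parameters (b q : ℕ) (1<q : 1 < q) (k : ℕ) .{{_ : NonZero k}} (k≡9b : k ≡ 9 ℕ.* b) where
  open import Data.Nat using (_+_; _^_)

  D : ℕ
  D = suc k ℕ.* (4 + k)

  -- Every range is rounded up to a power of `q`, which makes `n` a power of `q`: the q + 1 layers
  -- to q^2, the coordinates below 2q^(k+1) to q^(k+2), the heights up to q^(2k+1) to q^(2k+2).
  open Construction k (q ^ 2) (q ^ (2 + k)) (q ^ (2 + (k + k))) (q ^ k) public

  private
    instance
      q≢0 : NonZero q
      q≢0 = ℕ.>-nonZero (ℕₚ.<-trans (s≤s z≤n) 1<q)

  n≡q^D : n ≡ q ^ D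
  n≡q^D = begin
    q ^ 2 ℕ.* ((q ^ (2 + k)) ^ k ℕ.* (q ^ (2 + (k + k)) ℕ.* q ^ k))
      ≡⟨ cong₂ (λ x y → q ^ 2 ℕ.* (x ℕ.* y)) (ℕₚ.^-*-assoc q (2 + k) k) (≡.sym (ℕₚ.^-distribˡ-+-* q (2 + (k + k)) k)) ⟩
    q ^ 2 ℕ.* (q ^ ((2 + k) ℕ.* k) ℕ.* q ^ (2 + (k + k) + k))
      ≡⟨ cong (q ^ 2 ℕ.*_) (ℕₚ.^-distribˡ-+-* q ((2 + k) ℕ.* k) _) ⟨
    q ^ 2 ℕ.* q ^ ((2 + k) ℕ.* k + (2 + (k + k) + k))
      ≡⟨ ℕₚ.^-distribˡ-+-* q 2 ((2 + k) ℕ.* k + (2 + (k + k) + k)) ⟨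
    q ^ (2 + ((2 + k) ℕ.* k + (2 + (k + k) + k)))
      ≡⟨ cong (q ^_) (exponent k) ⟩
    q ^ D ∎
    where
    open ≡-Reasoning
    exponent : ∀ k → 2 + ((2 + k) ℕ.* k + (2 + (k + k) + k)) ≡ suc k ℕ.* (4 + k)
    exponent = ℕRing.solve-∀

  q≤n : q ℕ.≤ n
  q≤n = subst (q ℕ.≤_) (≡.sym n≡q^D) (ℕₚ.m≤m*n q (q ^ (3 + k + k ℕ.* (4 + k))) {{ℕₚ.m^n≢0 q (3 + k + k ℕ.* (4 + k))}})

  0<n : 0 < n
  0<n = ℕₚ.<-≤-trans (ℕ.>-nonZero⁻¹ q) q≤n

  q<τ : q < q ^ 2
  q<τ = subst (_< q ^ 2) (ℕₚ.^-identityʳ q) (ℕₚ.^-monoʳ-< q 1<q {1} {2} (s≤s (s≤s z≤n)))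

  X-fits : q ^ suc k + q ℕ.* q ^ k ℕ.≤ q ^ (2 + k)
  X-fits = subst (ℕ._≤ q ^ (2 + k)) (cong (λ r → q ^ suc k + r) (ℕₚ.+-identityʳ (q ^ suc k)))
    (ℕₚ.*-monoˡ-≤ (q ^ suc k) 1<q)

  Y-fits : q ℕ.* (q ^ k ℕ.* q ^ k) < q ^ (2 + (k + k))
  Y-fits = subst (_< q ^ (2 + (k + k))) (cong (q ℕ.*_) (ℕₚ.^-distribˡ-+-* q k k))
    (ℕₚ.^-monoʳ-< q 1<q (ℕₚ.n<1+n (suc (k + k))))

  -- If `x` reached the number q^(k(2k+1)) of pairs, the hypothesis would compare powers of `q` in
  -- the wrong order: for k = 9b the exponent k(2k+1)b + D exceeds b + 2bD by 4(k + 1).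
  few-edges : ∀ {x} → x ^ b ℕ.* n ℕ.≤ q ^ b ℕ.* n ^ (2 ℕ.* b) → x < Pairs (q ^ suc k)
  few-edges {x} x-le = ℕₚ.≰⇒> λ pairs≤x → ℕₚ.<⇒≱ too-many (ℕₚ.≤-trans (ℕₚ.*-monoˡ-≤ n (ℕₚ.^-monoˡ-≤ b pairs≤x)) x-le)
    where
    open ℕₚ.≤-Reasoning
    -- k = 9b is chosen so that this holds: the difference of the sides is (k+1)(k+4) − 9b(k+1).
    gap : b + D ℕ.* (2 ℕ.* b) < (suc k ℕ.* k + k ℕ.* k) ℕ.* b + D
    gap = begin
      suc (b + D ℕ.* (2 ℕ.* b))
        ≤⟨ ℕₚ.m≤m+n _ (3 ℕ.* suc k + k) ⟩
      suc (b + D ℕ.* (2 ℕ.* b)) + (3 ℕ.* suc k + k)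
        ≡⟨ cong (λ k → suc (b + suc k ℕ.* (4 + k) ℕ.* (2 ℕ.* b)) + (3 ℕ.* suc k + k)) k≡9b ⟩
      suc (b + suc (9 ℕ.* b) ℕ.* (4 + 9 ℕ.* b) ℕ.* (2 ℕ.* b)) + (3 ℕ.* suc (9 ℕ.* b) + 9 ℕ.* b)
        ≡⟨ identity b ⟩
      (suc (9 ℕ.* b) ℕ.* (9 ℕ.* b) + 9 ℕ.* b ℕ.* (9 ℕ.* b)) ℕ.* b + suc (9 ℕ.* b) ℕ.* (4 + 9 ℕ.* b)
        ≡⟨ cong (λ k → (suc k ℕ.* k + k ℕ.* k) ℕ.* b + suc k ℕ.* (4 + k)) k≡9b ⟨
      (suc k ℕ.* k + k ℕ.* k) ℕ.* b + D ∎
      where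
      identity : ∀ b → suc (b + suc (9 ℕ.* b) ℕ.* (4 + 9 ℕ.* b) ℕ.* (2 ℕ.* b)) + (3 ℕ.* suc (9 ℕ.* b) + 9 ℕ.* b) ≡
                 (suc (9 ℕ.* b) ℕ.* (9 ℕ.* b) + 9 ℕ.* b ℕ.* (9 ℕ.* b)) ℕ.* b + suc (9 ℕ.* b) ℕ.* (4 + 9 ℕ.* b)
      identity = ℕRing.solve-∀
    too-many : q ^ b ℕ.* n ^ (2 ℕ.* b) < Pairs (q ^ suc k) ^ b ℕ.* n
    too-many = begin-strict
      q ^ b ℕ.* n ^ (2 ℕ.* b)
        ≡⟨ cong (λ m → q ^ b ℕ.* m ^ (2 ℕ.* b)) n≡q^D ⟩
      q ^ b ℕ.* (q ^ D) ^ (2 ℕ.* b)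
        ≡⟨ cong (q ^ b ℕ.*_) (ℕₚ.^-*-assoc q D (2 ℕ.* b)) ⟩
      q ^ b ℕ.* q ^ (D ℕ.* (2 ℕ.* b))
        ≡⟨ ℕₚ.^-distribˡ-+-* q b _ ⟨
      q ^ (b + D ℕ.* (2 ℕ.* b))
        <⟨ ℕₚ.^-monoʳ-< q 1<q gap ⟩
      q ^ ((suc k ℕ.* k + k ℕ.* k) ℕ.* b + D)
        ≡⟨ ℕₚ.^-distribˡ-+-* q ((suc k ℕ.* k + k ℕ.* k) ℕ.* b) D ⟩
      q ^ ((suc k ℕ.* k + k ℕ.* k) ℕ.* b) ℕ.* q ^ D
        ≡⟨ cong₂ ℕ._*_ (ℕₚ.^-*-assoc q (suc k ℕ.* k + k ℕ.* k) b) n≡q^D ⟨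
      (q ^ (suc k ℕ.* k + k ℕ.* k)) ^ b ℕ.* n
        ≡⟨ cong (λ p → p ^ b ℕ.* n) (≡.trans (ℕₚ.^-distribˡ-+-* q (suc k ℕ.* k) (k ℕ.* k))
             (cong₂ ℕ._*_ (≡.sym (ℕₚ.^-*-assoc q (suc k) k)) (≡.sym (ℕₚ.^-*-assoc q k k)))) ⟩
      Pairs (q ^ suc k) ^ b ℕ.* n ∎

-- Assembly: constants depending on ε alone, and a base `q` that absorbs `N` and `C`.

open import Data.Integer using (+_)

theorem5p3 : (ε : ℚ) → ε > 0ℚ →
    Σ ℚ λ δ → δ > 0ℚ × Σ ℚ λ K → K > 0ℚ ×
    ((C : ℚ) → C > 0ℚ →
    Σ ℚ λ c → c > 0ℚ ×
    ((N : ℕ) → Σ ℕ λ n → N ℕ.≤ n × 0 < n ×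
    Σ (Graph n) λ G →
    (toℚ (size G) ≤ K * toℚ n) ×
    ((H : Graph n) → ShortcutSet G H →
    AtMostCPow (size H) C n ((+ 2 / 1) - ε) →
    DiameterAtLeast (G ∪ H) c δ)))
theorem5p3 ε ε>0 =
  δ , positive⁻¹ δ , 1ℚ , positive⁻¹ 1ℚ , λ C C>0 → c , positive⁻¹ c , λ N →
  -- The summand 2 gives 1 < q, `N` gives N ≤ q ≤ n, and the numerator of `C` gives C ≤ q.
  let q = 2 ℕ.+ (N ℕ.+ ℤ.∣ ↥ C ∣)
      open Parameters b q (s≤s (s≤s z≤n)) k refl
      C≤q : C ≤ toℚ q
      C≤q = ≤-trans (≤-numerator C C>0) (toℚ-mono (ℕₚ.≤-trans (ℕₚ.m≤n+m _ N) (ℕₚ.m≤n+m _ 2)))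
  in n , ℕₚ.≤-trans (ℕₚ.≤-trans (ℕₚ.m≤m+n N _) (ℕₚ.m≤n+m _ 2)) q≤n , 0<n , G
   , ≤-trans (toℚ-mono size-G) (≤-reflexive (≡.sym (*-identityˡ (toℚ n))))
   , λ H H-shortcut H-small →
     let u , v , reach , far = far-pair {q} {q ℕ.^ suc k} q<τ X-fits Y-fits H-shortcut
                                 (few-edges (atMost⇒≤ {size H} {C} {q} {n} {e} C>0 C≤q e<2 0<n H-small))
     in u , v , reach , λ ℓ w →
        atLeast-root {c} {q} {n} {ℓ} {3 ℕ.+ k ℕ.+ k ℕ.* (4 ℕ.+ k)} n≡q^D (reciprocal-bound {q = q} {ℓ} (far ℓ w))
  where
  e : ℚ
  e = (+ 2 / 1) - ε
  b k : ℕ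
  b = ↧ₙ e
  k = 9 ℕ.* b
  δ c : ℚ
  -- The second field is the denominator minus one, so δ = 1/D with D = (k + 1)(k + 4), the exponent
  -- for which n = q^D.
  δ = mkℚ (+ 1) (3 ℕ.+ k ℕ.+ k ℕ.* (4 ℕ.+ k)) (1-coprimeTo _)
  c = 1/ integerℚ k
  e<2 : e ℚ.< + 2 / 1
  e<2 = subst (e ℚ.<_) (+-identityʳ (+ 2 / 1)) (+-monoʳ-< (+ 2 / 1) (neg-antimono-< ε>0))
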